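{- Let $n\ge 1$ be an integer and let $k=2n$. Put $N=k^2+\frac{5}{2}k+1$ (equivalently $N=4n^2+5n+1$), $a=n$ and $b=3n+1$. Then the three-quarters digraph $TQ(N,a,b)$ has diameter $k$. In particular, for every even $k\ge 2$ there exists a three-quarters digraph with diameter $k$ and $k^2+\frac{5}{2}k+1$ vertices.
   Context: For integers $N\ge 2$ and $1\le a,b\le N-1$ with $\gcd(N,a,b)=1$, the three-quarters digraph $TQ(N,a,b)$ has vertex set $\mathbb{Z}_N$ (integers modulo $N$), and each vertex $i$ is joined by arcs to $i+a$ and $i+b$ (mod $N$); it is the circulant digraph with steps $a,b$, equipped with the following distance-like function. For $x,y\in\mathbb{Z}_N$, $d(x,y)$ is the minimum integer $\ell\ge 0$ such that there exist integers $m,n'\ge 0$ with $m+n'=\ell$ and $$y-x\equiv ma+n'b,\quad\text{or}\quad y-x\equiv -ma+n'b,\quad\text{or}\quad y-x\equiv ma-n'b \pmod N.$$ (The combination $-ma-n'b$ with both $m,n'>0$ is not allowed.) The function $d$ is translation invariant, $d(x,y)=d(0,y-x)$, but need not be symmetric. The diameter of $TQ(N,a,b)$ is $\max_{x,y\in\mathbb{Z}_N} d(x,y)=\max_{z\in\mathbb{Z}_N} d(0,z)$. -}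

module Defs where

open import Data.Fin using (Fin; toℕ)
open import Data.Integer using (ℤ; +_; -_; _+_; _-_; _*_)
open import Data.Integer.Divisibility.Signed using (_∣_)
open import Data.Nat using (ℕ; _≤_; _<_)
import Data.Nat as ℕ
open import Data.Nat.GCD using (gcd)
open import Data.Product using (_×_; ∃-syntax)
open import Data.Sum using (_⊎_)
open import Relation.Binary.PropositionalEquality using (_≡_)

infix 4 _≡_[mod_]

_≡_[mod_] : ℤ → ℤ → ℕ → Set
x ≡ y [mod N ] = + N ∣ (x - y)

record IsTQ (N a b : ℕ) : Set where
  field
    2≤N  : 2 ≤ N
    1≤a  : 1 ≤ a
    a<N  : a < N
    1≤b  : 1 ≤ b
    b<N  : b < N
    gcd1 : gcd N (gcd a b) ≡ 1

record ThreeQuartersDigraph : Set where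
  constructor TQ
  field
    order  : ℕ
    step₁  : ℕ
    step₂  : ℕ
    isTQ   : IsTQ order step₁ step₂

  -- ℤ_N through its residues 0, …, N-1.
  Vertex : Set
  Vertex = Fin order

  ⟦_⟧ : Vertex → ℤ
  ⟦ x ⟧ = + toℕ x

  -- Proof-relevant, so that equal steps give two parallel arcs.
  Arc : Vertex → Vertex → Set
  Arc x y = ⟦ y ⟧ ≡ ⟦ x ⟧ + + step₁ [mod order ]
          ⊎ ⟦ y ⟧ ≡ ⟦ x ⟧ + + step₂ [mod order ]

  -- The congruences admissible for reaching y from x with m uses of the first
  -- step and n of the second: all sign patterns except two minus signs.
  Joins : Vertex → Vertex → ℕ → ℕ → Set
  Joins x y m n =
      ⟦ y ⟧ - ⟦ x ⟧ ≡ + m * + step₁ + + n * + step₂ [mod order ]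
    ⊎ ⟦ y ⟧ - ⟦ x ⟧ ≡ - (+ m * + step₁) + + n * + step₂ [mod order ]
    ⊎ ⟦ y ⟧ - ⟦ x ⟧ ≡ + m * + step₁ - + n * + step₂ [mod order ]

  Reaches : Vertex → Vertex → ℕ → Set
  Reaches x y ℓ = ∃[ m ] ∃[ n ] m ℕ.+ n ≡ ℓ × Joins x y m n

  -- The graph of the function d: d(x , y) = ℓ.
  Distance : Vertex → Vertex → ℕ → Set
  Distance x y ℓ = Reaches x y ℓ × (∀ ℓ′ → Reaches x y ℓ′ → ℓ ≤ ℓ′)

  -- k is the maximum of d; the first component also asserts that d is total.
  HasDiameter : ℕ → Set
  HasDiameter k = (∀ x y → ∃[ ℓ ] Distance x y ℓ × ℓ ≤ k)
                × (∃[ x ] ∃[ y ] Distance x y k)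

{-# OPTIONS --safe #-}

-- Put M = 4n + 1 = a + b, so that N = M (n + 1) and s a + t b = (s - t) n + t M.
-- As -4 inverts n modulo M, each z is w n + u M with |w| ≤ 2n, and u only
-- matters modulo n + 1.  For w ≥ 0 the n + 1 consecutive values
-- t = -⌈w/2⌉, …, n - ⌈w/2⌉ give s = t + w ≥ 0 and |s| + |t| ≤ 2n; for w ≤ 0
-- exchange s and t.  Conversely z = 2n² forces s - t ≡ 2n modulo M, whence
-- |s| + |t| ≥ 2n.
module Submission where

open import Defs
open import Data.Fin using (fromℕ<)
import Data.Fin.Properties as Fin
open import Data.Integer as ℤ using (ℤ; +_; ∣_∣)
open import Data.Integer.DivMod using (_%ℕ_; _/ℕ_; a≡a%ℕn+[a/ℕn]*n; n%ℕd<d)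
import Data.Integer.Divisibility.Signed as ℤ
import Data.Integer.Properties as ℤ
import Data.Integer.Tactic.RingSolver as ℤ-Ring
open import Data.Nat using
  (ℕ; zero; suc; _+_; _*_; _^_; _∸_; _≤_; _<_; z≤n; s≤s; s≤s⁻¹; ⌊_/2⌋; ⌈_/2⌉)
open import Data.Nat.DivMod using (_/_; m*n/n≡m)
open import Data.Nat.Divisibility using
  (_∣_; divides; ∣⇒≤; ∣m+n∣m⇒∣n; ∣n⇒∣m*n; ∣1⇒≡1)
open import Data.Nat.GCD using (gcd; gcd[m,n]∣m; gcd[m,n]∣n; gcd-zeroʳ)
open import Data.Nat.Properties
import Data.Nat.Tactic.RingSolver as ℕ-Ring
open import Data.Product using (_×_; Σ-syntax; ∃-syntax; _,_)
open import Data.Sum using (_⊎_; inj₁; inj₂; map)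
open import Relation.Binary.PropositionalEquality
  using (_≡_; refl; sym; trans; cong; cong₂; subst; subst₂; module ≡-Reasoning)
open import Relation.Nullary using (Dec; yes; no; contradiction)
open import Relation.Nullary.Decidable using (map′; _⊎-dec_)
open import Relation.Unary using (Decidable)
open ThreeQuartersDigraph using (order; HasDiameter)

-- Minimal lengths and decidability of reachability.

-- The search goes upward from 0, shifting the predicate after each failure, and the known witness
-- `m` limits its depth. It turns any short representation into an exact `Distance`.
least-witness : ∀ {p} {P : ℕ → Set p} → Decidable P → ∀ m → P m →
  ∃[ ℓ ] (P ℓ × (∀ ℓ′ → P ℓ′ → ℓ ≤ ℓ′)) × ℓ ≤ m
least-witness P? zero    P0 = zero , (P0 , λ _ _ → z≤n) , z≤n
least-witness {P = P} P? (suc m) Pm with P? 0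
... | yes P0 = zero , (P0 , λ _ _ → z≤n) , z≤n
... | no ¬P0 with least-witness {P = λ ℓ → P (suc ℓ)} (λ ℓ → P? (suc ℓ)) m Pm
...   | ℓ , (Pℓ , ℓ-least) , ℓ≤m = suc ℓ , (Pℓ , suc-least) , s≤s ℓ≤m
  where
  suc-least : ∀ ℓ′ → P ℓ′ → suc ℓ ≤ ℓ′
  suc-least zero     P0  = contradiction P0 ¬P0
  suc-least (suc ℓ′) Pℓ′ = s≤s (ℓ-least ℓ′ Pℓ′)

module _ (G : ThreeQuartersDigraph) where
  open ThreeQuartersDigraph G hiding (order; HasDiameter)

  joins? : ∀ x y m n → Dec (Joins x y m n)
  joins? x y m n = (_ ℤ.∣? _) ⊎-dec (_ ℤ.∣? _) ⊎-dec (_ ℤ.∣? _)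

  -- A fixed length `ℓ` leaves only finitely many candidates: `m ≤ ℓ`, and then the other count is
  -- `ℓ ∸ m`.
  reaches? : ∀ x y → Decidable (Reaches x y)
  reaches? x y ℓ = map′ to from
    (anyUpTo? (λ m → joins? x y m (ℓ ∸ m)) (suc ℓ))
    where
    to : ∃[ m ] m < suc ℓ × Joins x y m (ℓ ∸ m) → Reaches x y ℓ
    to (m , m<1+ℓ , j) = m , ℓ ∸ m , m+[n∸m]≡n (s≤s⁻¹ m<1+ℓ) , j
    from : Reaches x y ℓ → ∃[ m ] m < suc ℓ × Joins x y m (ℓ ∸ m)
    from (m , n , refl , j) =
      m , s≤s (m≤m+n m n) , subst (Joins x y m) (sym (m+n∸m≡n m n)) j

  joins⇒distance : ∀ x y m n {k} → m + n ≤ k → Joins x y m n →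
    ∃[ ℓ ] Distance x y ℓ × ℓ ≤ k
  joins⇒distance x y m n m+n≤k j
    with least-witness (reaches? x y) (m + n) (m , n , refl , j)
  ... | ℓ , d , ℓ≤m+n = ℓ , d , ≤-trans ℓ≤m+n m+n≤k

-- Division with centred remainder.

centred : ∀ m r → r ≤ m + m → ∃[ v ] v ≤ m ×
  (+ r ≡ + v ℤ.+ + m ⊎ + r ≡ ℤ.- + v ℤ.+ + m)
centred m r r≤m+m with ≤-total m r
... | inj₁ m≤r = r ∸ m , m≤n+o⇒m∸n≤o r m r≤m+m , inj₁ (cong +_ (sym (m∸n+n≡m m≤r)))
... | inj₂ r≤m = m ∸ r , m∸n≤m m r , inj₂ (begin
  + r                                  ≡⟨ cancel (+ (m ∸ r)) (+ r) ⟩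
  ℤ.- + (m ∸ r) ℤ.+ + (m ∸ r + r)      ≡⟨ cong (λ i → ℤ.- + (m ∸ r) ℤ.+ + i) (m∸n+n≡m r≤m) ⟩
  ℤ.- + (m ∸ r) ℤ.+ + m                ∎)
  where
  open ≡-Reasoning
  cancel : ∀ i j → j ≡ ℤ.- i ℤ.+ (i ℤ.+ j)
  cancel = ℤ-Ring.solve-∀

-- Dividing `z + m` instead of `z` and subtracting `m` afterwards moves the remainders from 0, ...,
-- 2m to -m, ..., m. The absolute value `v` is a natural number so that it can be halved later.
centred-remainder : ∀ z m → ∃[ v ] ∃[ q ] v ≤ m ×
  (z ≡ + v ℤ.+ q ℤ.* + suc (m + m) ⊎ z ≡ ℤ.- + v ℤ.+ q ℤ.* + suc (m + m))
centred-remainder z m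
  with centred m _ (s≤s⁻¹ (n%ℕd<d (z ℤ.+ + m) (suc (m + m))))
... | v , v≤m , r≡ = v , q , v≤m , map (shift (+ v)) (shift (ℤ.- + v)) r≡
  where
  q = (z ℤ.+ + m) /ℕ suc (m + m)
  cancel : ∀ i j → i ≡ (i ℤ.+ j) ℤ.- j
  cancel = ℤ-Ring.solve-∀
  regroup : ∀ w i j → ((w ℤ.+ i) ℤ.+ j) ℤ.- i ≡ w ℤ.+ j
  regroup = ℤ-Ring.solve-∀
  shift : ∀ w → + ((z ℤ.+ + m) %ℕ suc (m + m)) ≡ w ℤ.+ + m →
    z ≡ w ℤ.+ q ℤ.* + suc (m + m)
  shift w r≡w+m = begin
    z                                           ≡⟨ cancel z (+ m) ⟩
    (z ℤ.+ + m) ℤ.- + m                         ≡⟨ cong (ℤ._- + m) (a≡a%ℕn+[a/ℕn]*n (z ℤ.+ + m) (suc (m + m))) ⟩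
    (+ ((z ℤ.+ + m) %ℕ suc (m + m)) ℤ.+ q ℤ.* + suc (m + m)) ℤ.- + m
                                                ≡⟨ cong (λ i → (i ℤ.+ q ℤ.* + suc (m + m)) ℤ.- + m) r≡w+m ⟩
    ((w ℤ.+ + m) ℤ.+ q ℤ.* + suc (m + m)) ℤ.- + m
                                                ≡⟨ regroup w (+ m) (q ℤ.* + suc (m + m)) ⟩
    w ℤ.+ q ℤ.* + suc (m + m)                   ∎
    where open ≡-Reasoning

-- Upper bound: short representations of every integer modulo N.

step₂ᶻ : ℤ → ℤ
step₂ᶻ n = + 3 ℤ.* n ℤ.+ + 1

orderᶻ : ℤ → ℤ
orderᶻ n = (+ 1 ℤ.+ + 4 ℤ.* n) ℤ.* (+ 1 ℤ.+ n)

-- `f` and `c` are the two halves of `v` = |w|, and `r` is the offset inside the window of n + 1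
-- consecutive values. One coefficient is `r + f`, which is nonnegative, so the forbidden pattern of
-- two minus signs never arises.
cover : ∀ n z → ∃[ r ] ∃[ f ] ∃[ c ] ∃[ q ]
  r ≤ n × f ≤ c × f + c ≤ 2 * n ×
  ( z ≡ (+ r ℤ.+ + f) ℤ.* + n ℤ.+ (+ r ℤ.- + c) ℤ.* step₂ᶻ (+ n) ℤ.+ q ℤ.* orderᶻ (+ n)
  ⊎ z ≡ (+ r ℤ.- + c) ℤ.* + n ℤ.+ (+ r ℤ.+ + f) ℤ.* step₂ᶻ (+ n) ℤ.+ q ℤ.* orderᶻ (+ n))
-- Since -4n = 1 - M, the centred remainder of -4z modulo M = 2n + 2n + 1 is the required w.
cover n z with centred-remainder (ℤ.- (+ 4) ℤ.* z) (2 * n)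
... | v , q , v≤2n , w≡ = by-sign w≡
  where
  open ≡-Reasoning
  f = ⌊ v /2⌋
  c = ⌈ v /2⌉
  f+c≤2n : f + c ≤ 2 * n
  f+c≤2n = subst (_≤ 2 * n) (sym (⌊n/2⌋+⌈n/2⌉≡n v)) v≤2n
  v≡f+c : + v ≡ + f ℤ.+ + c
  v≡f+c = cong +_ (sym (⌊n/2⌋+⌈n/2⌉≡n v))
  M≡ : + suc (2 * n + 2 * n) ≡ + 1 ℤ.+ + 4 ℤ.* + n
  M≡ = begin
    + suc (2 * n + 2 * n)  ≡⟨ cong (λ i → + suc i) (double n) ⟩
    + 1 ℤ.+ + (4 * n)      ≡⟨ cong (λ i → + 1 ℤ.+ i) (ℤ.pos-* 4 n) ⟩
    + 1 ℤ.+ + 4 ℤ.* + n    ∎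
    where
    double : ∀ n → 2 * n + 2 * n ≡ 4 * n
    double = ℕ-Ring.solve-∀

  -- The u of the header is z + q n, and (s , t) = (y + w , y).
  solution : ∀ {w} p y → ℤ.- (+ 4) ℤ.* z ≡ w ℤ.+ q ℤ.* + suc (2 * n + 2 * n) →
    z ℤ.+ q ℤ.* + n ≡ y ℤ.+ p ℤ.* (+ 1 ℤ.+ + n) →
    z ≡ (y ℤ.+ w) ℤ.* + n ℤ.+ y ℤ.* step₂ᶻ (+ n) ℤ.+ p ℤ.* orderᶻ (+ n)
  solution {w} p y w≡ u≡ = begin
    z
      ≡⟨ e₁ z ν ⟩
    ℤ.- (+ 4) ℤ.* z ℤ.* ν ℤ.+ z ℤ.* (+ 1 ℤ.+ + 4 ℤ.* ν)
      ≡⟨ cong (λ i → i ℤ.* ν ℤ.+ z ℤ.* (+ 1 ℤ.+ + 4 ℤ.* ν)) (trans w≡ (cong (λ i → w ℤ.+ q ℤ.* i) M≡)) ⟩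
    (w ℤ.+ q ℤ.* (+ 1 ℤ.+ + 4 ℤ.* ν)) ℤ.* ν ℤ.+ z ℤ.* (+ 1 ℤ.+ + 4 ℤ.* ν)
      ≡⟨ e₂ z ν w q ⟩
    w ℤ.* ν ℤ.+ (z ℤ.+ q ℤ.* ν) ℤ.* (+ 1 ℤ.+ + 4 ℤ.* ν)
      ≡⟨ cong (λ i → w ℤ.* ν ℤ.+ i ℤ.* (+ 1 ℤ.+ + 4 ℤ.* ν)) u≡ ⟩
    w ℤ.* ν ℤ.+ (y ℤ.+ p ℤ.* (+ 1 ℤ.+ ν)) ℤ.* (+ 1 ℤ.+ + 4 ℤ.* ν)
      ≡⟨ e₃ ν w y p ⟩
    (y ℤ.+ w) ℤ.* ν ℤ.+ y ℤ.* (+ 3 ℤ.* ν ℤ.+ + 1) ℤ.+ p ℤ.* ((+ 1 ℤ.+ + 4 ℤ.* ν) ℤ.* (+ 1 ℤ.+ ν))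
      ∎
    where
    ν = + n
    e₁ : ∀ z ν → z ≡ ℤ.- (+ 4) ℤ.* z ℤ.* ν ℤ.+ z ℤ.* (+ 1 ℤ.+ + 4 ℤ.* ν)
    e₁ = ℤ-Ring.solve-∀
    e₂ : ∀ z ν w q → (w ℤ.+ q ℤ.* (+ 1 ℤ.+ + 4 ℤ.* ν)) ℤ.* ν ℤ.+ z ℤ.* (+ 1 ℤ.+ + 4 ℤ.* ν)
       ≡ w ℤ.* ν ℤ.+ (z ℤ.+ q ℤ.* ν) ℤ.* (+ 1 ℤ.+ + 4 ℤ.* ν)
    e₂ = ℤ-Ring.solve-∀
    e₃ : ∀ ν w y p → w ℤ.* ν ℤ.+ (y ℤ.+ p ℤ.* (+ 1 ℤ.+ ν)) ℤ.* (+ 1 ℤ.+ + 4 ℤ.* ν)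
       ≡ (y ℤ.+ w) ℤ.* ν ℤ.+ y ℤ.* (+ 3 ℤ.* ν ℤ.+ + 1) ℤ.+ p ℤ.* ((+ 1 ℤ.+ + 4 ℤ.* ν) ℤ.* (+ 1 ℤ.+ ν))
    e₃ = ℤ-Ring.solve-∀

  u : ℤ
  u = z ℤ.+ q ℤ.* + n

  -- The shift `d` selects the window -d, ..., n - d in which t represents `u` modulo n + 1.
  remainder : ∀ d → u ≡ + ((u ℤ.+ d) %ℕ suc n) ℤ.- d ℤ.+ ((u ℤ.+ d) /ℕ suc n) ℤ.* (+ 1 ℤ.+ + n)
  remainder d = begin
    u                ≡⟨ e₁ u d ⟩
    (u ℤ.+ d) ℤ.- d  ≡⟨ cong (ℤ._- d) (a≡a%ℕn+[a/ℕn]*n (u ℤ.+ d) (suc n)) ⟩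
    (+ ((u ℤ.+ d) %ℕ suc n) ℤ.+ ((u ℤ.+ d) /ℕ suc n) ℤ.* + suc n) ℤ.- d
                     ≡⟨ e₂ (+ ((u ℤ.+ d) %ℕ suc n)) (((u ℤ.+ d) /ℕ suc n) ℤ.* + suc n) d ⟩
    + ((u ℤ.+ d) %ℕ suc n) ℤ.- d ℤ.+ ((u ℤ.+ d) /ℕ suc n) ℤ.* + suc n ∎
    where
    e₁ : ∀ u d → u ≡ (u ℤ.+ d) ℤ.- d
    e₁ = ℤ-Ring.solve-∀
    e₂ : ∀ i j d → (i ℤ.+ j) ℤ.- d ≡ i ℤ.- d ℤ.+ j
    e₂ = ℤ-Ring.solve-∀

  combination : ℤ → ℤ → ℤ → ℤ
  combination p s t = s ℤ.* + n ℤ.+ t ℤ.* step₂ᶻ (+ n) ℤ.+ p ℤ.* orderᶻ (+ n)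

  by-sign : _ → _
  by-sign (inj₁ w≡) =
    r , f , c , p , s≤s⁻¹ (n%ℕd<d (u ℤ.+ + c) (suc n)) , ⌊n/2⌋≤⌈n/2⌉ v , f+c≤2n ,
    inj₁ (trans (solution p (+ r ℤ.- + c) w≡ (remainder (+ c)))
      (cong (λ s → combination p s (+ r ℤ.- + c)) s≡))
    where
    r = (u ℤ.+ + c) %ℕ suc n
    p = (u ℤ.+ + c) /ℕ suc n
    e : ∀ r f c → r ℤ.- c ℤ.+ (f ℤ.+ c) ≡ r ℤ.+ f
    e = ℤ-Ring.solve-∀
    s≡ : + r ℤ.- + c ℤ.+ + v ≡ + r ℤ.+ + f
    s≡ = trans (cong (λ i → + r ℤ.- + c ℤ.+ i) v≡f+c) (e (+ r) (+ f) (+ c))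
  -- For w = -v the window of t starts at `f`, so that s = t - v starts at `f - v`, which is `- c`.
  by-sign (inj₂ w≡) =
    r , f , c , p , s≤s⁻¹ (n%ℕd<d (u ℤ.+ ℤ.- + f) (suc n)) , ⌊n/2⌋≤⌈n/2⌉ v , f+c≤2n ,
    inj₂ (trans (solution p (+ r ℤ.- ℤ.- + f) w≡ (remainder (ℤ.- + f)))
      (cong₂ (combination p) s≡ (cong (λ i → + r ℤ.+ i) (ℤ.neg-involutive (+ f)))))
    where
    r = (u ℤ.+ ℤ.- + f) %ℕ suc n
    p = (u ℤ.+ ℤ.- + f) /ℕ suc n
    e : ∀ r f c → r ℤ.- ℤ.- f ℤ.+ ℤ.- (f ℤ.+ c) ≡ r ℤ.- c
    e = ℤ-Ring.solve-∀
    s≡ : + r ℤ.- ℤ.- + f ℤ.+ ℤ.- + v ≡ + r ℤ.- + c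
    s≡ = trans (cong (λ i → + r ℤ.- ℤ.- + f ℤ.+ ℤ.- i) v≡f+c) (e (+ r) (+ f) (+ c))

-- Here `d` is |r - c|. If `c ≤ r`, then `f ≤ c` bounds the sum by 2r; if `r ≤ c`, then `r` cancels
-- and `f + c` remains.
±-difference : ∀ {n} r f c → r ≤ n → f ≤ c → f + c ≤ 2 * n → ∃[ d ] r + f + d ≤ 2 * n ×
  (+ r ℤ.- + c ≡ + d ⊎ + r ℤ.- + c ≡ ℤ.- + d)
±-difference {n} r f c r≤n f≤c f+c≤2n with ≤-total c r
... | inj₁ c≤r = r ∸ c , bound , inj₁ (trans (ℤ.m-n≡m⊖n r c) (ℤ.⊖-≥ c≤r))
  where
  open ≤-Reasoning
  bound : r + f + (r ∸ c) ≤ 2 * n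
  bound = begin
    r + f + (r ∸ c)    ≤⟨ +-monoˡ-≤ (r ∸ c) (+-monoʳ-≤ r f≤c) ⟩
    r + c + (r ∸ c)    ≡⟨ +-assoc r c (r ∸ c) ⟩
    r + (c + (r ∸ c))  ≡⟨ cong (λ i → r + i) (m+[n∸m]≡n c≤r) ⟩
    r + r              ≤⟨ +-mono-≤ r≤n (≤-trans r≤n (m≤m+n n 0)) ⟩
    2 * n              ∎
... | inj₂ r≤c = c ∸ r , bound , inj₂ (trans (ℤ.m-n≡m⊖n r c) (ℤ.⊖-≤ r≤c))
  where
  open ≤-Reasoning
  bound : r + f + (c ∸ r) ≤ 2 * n
  bound = begin
    r + f + (c ∸ r)    ≡⟨ cong (_+ (c ∸ r)) (+-comm r f) ⟩
    f + r + (c ∸ r)    ≡⟨ +-assoc f r (c ∸ r) ⟩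
    f + (r + (c ∸ r))  ≡⟨ cong (λ i → f + i) (m+[n∸m]≡n r≤c) ⟩
    f + c              ≤⟨ f+c≤2n ⟩
    2 * n              ∎

-- Lower bound at 2n².

-- The multiple s - t - 2n of M is either zero, and then |s - t| = 2n, or at least 4n + 1 in
-- absolute value, and then |s - t| > 2n.
2n≤∣s∣+∣t∣ : ∀ n s t →
  orderᶻ (+ n) ℤ.∣ + 2 ℤ.* + n ℤ.* + n ℤ.- (s ℤ.* + n ℤ.+ t ℤ.* step₂ᶻ (+ n)) →
  2 * n ≤ ∣ s ∣ + ∣ t ∣
2n≤∣s∣+∣t∣ n s t (ℤ.divides q eq) = by-size ∣ s ℤ.- t ℤ.- + (2 * n) ∣ refl
  where
  ν = + n
  M∣ : + (1 + 4 * n) ℤ.∣ s ℤ.- t ℤ.- + (2 * n)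
  -- Multiply the given equation by 4 and use 4n = M - 1 and 4(3n + 1) = 3M + 1; the quotient
  -- collects the multiples of M.
  M∣ = ℤ.divides (s ℤ.+ + 3 ℤ.* t ℤ.- + 2 ℤ.* ν ℤ.+ + 4 ℤ.* q ℤ.* (+ 1 ℤ.+ ν)) (begin
    s ℤ.- t ℤ.- + (2 * n)    ≡⟨ cong (λ i → s ℤ.- t ℤ.- i) (ℤ.pos-* 2 n) ⟩
    s ℤ.- t ℤ.- + 2 ℤ.* ν    ≡⟨ e₁ s t ν ⟩
    (s ℤ.+ + 3 ℤ.* t ℤ.- + 2 ℤ.* ν) ℤ.* (+ 1 ℤ.+ + 4 ℤ.* ν)
      ℤ.+ + 4 ℤ.* (+ 2 ℤ.* ν ℤ.* ν ℤ.- (s ℤ.* ν ℤ.+ t ℤ.* (+ 3 ℤ.* ν ℤ.+ + 1)))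
                             ≡⟨ cong (λ i → (s ℤ.+ + 3 ℤ.* t ℤ.- + 2 ℤ.* ν) ℤ.* (+ 1 ℤ.+ + 4 ℤ.* ν) ℤ.+ + 4 ℤ.* i) eq ⟩
    (s ℤ.+ + 3 ℤ.* t ℤ.- + 2 ℤ.* ν) ℤ.* (+ 1 ℤ.+ + 4 ℤ.* ν)
      ℤ.+ + 4 ℤ.* (q ℤ.* ((+ 1 ℤ.+ + 4 ℤ.* ν) ℤ.* (+ 1 ℤ.+ ν)))
                             ≡⟨ e₂ s t ν q ⟩
    (s ℤ.+ + 3 ℤ.* t ℤ.- + 2 ℤ.* ν ℤ.+ + 4 ℤ.* q ℤ.* (+ 1 ℤ.+ ν)) ℤ.* (+ 1 ℤ.+ + 4 ℤ.* ν)
                             ≡⟨ cong (λ i → (s ℤ.+ + 3 ℤ.* t ℤ.- + 2 ℤ.* ν ℤ.+ + 4 ℤ.* q ℤ.* (+ 1 ℤ.+ ν)) ℤ.* (+ 1 ℤ.+ i)) (sym (ℤ.pos-* 4 n)) ⟩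
    (s ℤ.+ + 3 ℤ.* t ℤ.- + 2 ℤ.* ν ℤ.+ + 4 ℤ.* q ℤ.* (+ 1 ℤ.+ ν)) ℤ.* + (1 + 4 * n) ∎)
    where
    open ≡-Reasoning
    e₁ : ∀ s t ν → s ℤ.- t ℤ.- + 2 ℤ.* ν ≡
      (s ℤ.+ + 3 ℤ.* t ℤ.- + 2 ℤ.* ν) ℤ.* (+ 1 ℤ.+ + 4 ℤ.* ν)
      ℤ.+ + 4 ℤ.* (+ 2 ℤ.* ν ℤ.* ν ℤ.- (s ℤ.* ν ℤ.+ t ℤ.* (+ 3 ℤ.* ν ℤ.+ + 1)))
    e₁ = ℤ-Ring.solve-∀
    e₂ : ∀ s t ν q →
      (s ℤ.+ + 3 ℤ.* t ℤ.- + 2 ℤ.* ν) ℤ.* (+ 1 ℤ.+ + 4 ℤ.* ν)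
      ℤ.+ + 4 ℤ.* (q ℤ.* ((+ 1 ℤ.+ + 4 ℤ.* ν) ℤ.* (+ 1 ℤ.+ ν))) ≡
      (s ℤ.+ + 3 ℤ.* t ℤ.- + 2 ℤ.* ν ℤ.+ + 4 ℤ.* q ℤ.* (+ 1 ℤ.+ ν)) ℤ.* (+ 1 ℤ.+ + 4 ℤ.* ν)
    e₂ = ℤ-Ring.solve-∀

  by-size : ∀ δ → ∣ s ℤ.- t ℤ.- + (2 * n) ∣ ≡ δ → 2 * n ≤ ∣ s ∣ + ∣ t ∣
  by-size zero δ≡ = subst (_≤ ∣ s ∣ + ∣ t ∣)
    (cong ∣_∣ (ℤ.i-j≡0⇒i≡j (s ℤ.- t) (+ (2 * n)) (ℤ.∣i∣≡0⇒i≡0 δ≡))) (ℤ.∣i-j∣≤∣i∣+∣j∣ s t)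
  by-size (suc δ) δ≡ = +-cancelʳ-≤ (2 * n) (2 * n) (∣ s ∣ + ∣ t ∣) (begin
    2 * n + 2 * n                ≡⟨ double n ⟩
    4 * n                        ≤⟨ n≤1+n (4 * n) ⟩
    1 + 4 * n                    ≤⟨ ∣⇒≤ (subst (1 + 4 * n ∣_) δ≡ (ℤ.∣⇒∣ᵤ M∣)) ⟩
    suc δ                        ≡⟨ δ≡ ⟨
    ∣ s ℤ.- t ℤ.- + (2 * n) ∣    ≤⟨ ℤ.∣i-j∣≤∣i∣+∣j∣ (s ℤ.- t) (+ (2 * n)) ⟩
    ∣ s ℤ.- t ∣ + 2 * n          ≤⟨ +-monoˡ-≤ (2 * n) (ℤ.∣i-j∣≤∣i∣+∣j∣ s t) ⟩
    ∣ s ∣ + ∣ t ∣ + 2 * n        ∎)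
    where
    open ≤-Reasoning
    double : ∀ n → 2 * n + 2 * n ≡ 4 * n
    double = ℕ-Ring.solve-∀

-- The diameter of the digraph.

module _ (n N : ℕ) (N≡ : N ≡ (1 + 4 * n) * (1 + n)) (tq : IsTQ N n (3 * n + 1)) where
  open ThreeQuartersDigraph (TQ N n (3 * n + 1) tq) hiding (order; HasDiameter)

  +N≡ : + N ≡ orderᶻ (+ n)
  +N≡ = begin
    + N                                    ≡⟨ cong +_ N≡ ⟩
    + ((1 + 4 * n) * (1 + n))              ≡⟨ ℤ.pos-* (1 + 4 * n) (1 + n) ⟩
    (+ 1 ℤ.+ + (4 * n)) ℤ.* (+ 1 ℤ.+ + n)  ≡⟨ cong (λ i → (+ 1 ℤ.+ i) ℤ.* (+ 1 ℤ.+ + n)) (ℤ.pos-* 4 n) ⟩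
    orderᶻ (+ n)                           ∎
    where open ≡-Reasoning

  +b≡ : + (3 * n + 1) ≡ step₂ᶻ (+ n)
  +b≡ = cong (ℤ._+ + 1) (ℤ.pos-* 3 n)

  congruent : ∀ {z x} q → z ≡ x ℤ.+ q ℤ.* orderᶻ (+ n) → z ≡ x [mod N ]
  congruent {z} {x} q z≡ = subst (ℤ._∣ (z ℤ.- x)) (sym +N≡)
    (ℤ.divides q (trans (cong (ℤ._- x) z≡) (e x (q ℤ.* orderᶻ (+ n)))))
    where
    e : ∀ x i → (x ℤ.+ i) ℤ.- x ≡ i
    e = ℤ-Ring.solve-∀

  -- The sign of `r - c` and the step carrying it decide which of the three congruences of `Joins`
  -- holds. For a negative sign, the last rewrite moves the minus outside the product, as `Joins`
  -- has it.
  cover⇒joins : ∀ x y {r f c q} → r ≤ n → f ≤ c → f + c ≤ 2 * n →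
    ( ⟦ y ⟧ ℤ.- ⟦ x ⟧ ≡ (+ r ℤ.+ + f) ℤ.* + n ℤ.+ (+ r ℤ.- + c) ℤ.* step₂ᶻ (+ n) ℤ.+ q ℤ.* orderᶻ (+ n)
    ⊎ ⟦ y ⟧ ℤ.- ⟦ x ⟧ ≡ (+ r ℤ.- + c) ℤ.* + n ℤ.+ (+ r ℤ.+ + f) ℤ.* step₂ᶻ (+ n) ℤ.+ q ℤ.* orderᶻ (+ n)) →
    ∃[ m ] ∃[ m′ ] m + m′ ≤ 2 * n × Joins x y m m′
  cover⇒joins x y {r} {f} {c} {q} r≤n f≤c f+c≤2n z≡ with ±-difference r f c r≤n f≤c f+c≤2n | z≡
  ... | d , bound , inj₁ r-c≡d | inj₁ z≡′ rewrite r-c≡d | sym +b≡ =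
    r + f , d , bound , inj₁ (congruent q z≡′)
  ... | d , bound , inj₂ r-c≡-d | inj₁ z≡′ rewrite r-c≡-d | sym +b≡ | sym (ℤ.neg-distribˡ-* (+ d) (+ (3 * n + 1))) =
    r + f , d , bound , inj₂ (inj₂ (congruent q z≡′))
  ... | d , bound , inj₁ r-c≡d | inj₂ z≡′ rewrite r-c≡d | sym +b≡ =
    d , r + f , subst (_≤ 2 * n) (+-comm (r + f) d) bound , inj₁ (congruent q z≡′)
  ... | d , bound , inj₂ r-c≡-d | inj₂ z≡′ rewrite r-c≡-d | sym +b≡ | sym (ℤ.neg-distribˡ-* (+ d) (+ n)) =
    d , r + f , subst (_≤ 2 * n) (+-comm (r + f) d) bound , inj₂ (inj₁ (congruent q z≡′))

  distance≤2n : ∀ x y → ∃[ ℓ ] Distance x y ℓ × ℓ ≤ 2 * n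
  distance≤2n x y with cover n (⟦ y ⟧ ℤ.- ⟦ x ⟧)
  ... | r , f , c , q , r≤n , f≤c , f+c≤2n , z≡
    with cover⇒joins x y {r} {f} {c} {q} r≤n f≤c f+c≤2n z≡
  ... | m , m′ , bound , j = joins⇒distance (TQ N n (3 * n + 1) tq) x y m m′ bound j

  2n²<N : 2 * n * n < N
  2n²<N = subst (2 * n * n <_) (sym (trans N≡ (e n))) (s≤s (m≤m+n (2 * n * n) _))
    where
    e : ∀ n → (1 + 4 * n) * (1 + n) ≡ suc (2 * n * n + (2 * n * n + 5 * n))
    e = ℕ-Ring.solve-∀

  origin far : Vertex
  origin = fromℕ< (≤-<-trans z≤n 2n²<N)
  far    = fromℕ< 2n²<N

  far-origin≡ : ⟦ far ⟧ ℤ.- ⟦ origin ⟧ ≡ + (2 * n) ℤ.* + n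
  far-origin≡ = begin
    ⟦ far ⟧ ℤ.- ⟦ origin ⟧  ≡⟨ cong₂ (λ i j → + i ℤ.- + j) (Fin.toℕ-fromℕ< 2n²<N) (Fin.toℕ-fromℕ< (≤-<-trans z≤n 2n²<N)) ⟩
    + (2 * n * n) ℤ.- + 0   ≡⟨ ℤ.+-identityʳ (+ (2 * n * n)) ⟩
    + (2 * n * n)           ≡⟨ ℤ.pos-* (2 * n) n ⟩
    + (2 * n) ℤ.* + n       ∎
    where open ≡-Reasoning

  -- Each sign pattern is absorbed into signed coefficients with |s| = m and |t| = m′, to which the
  -- lower bound at 2n² applies.
  joins-far⇒2n≤ : ∀ m m′ → Joins origin far m m′ → 2 * n ≤ m + m′
  joins-far⇒2n≤ m m′ = by-sign
    where
    bound : ∀ s t → ∣ s ∣ ≡ m → ∣ t ∣ ≡ m′ →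
      ⟦ far ⟧ ℤ.- ⟦ origin ⟧ ≡ s ℤ.* + n ℤ.+ t ℤ.* + (3 * n + 1) [mod N ] → 2 * n ≤ m + m′
    bound s t refl refl h = 2n≤∣s∣+∣t∣ n s t
      (subst₂ ℤ._∣_ +N≡
        (cong₂ (λ i j → i ℤ.- (s ℤ.* + n ℤ.+ t ℤ.* j))
          (trans far-origin≡ (cong (ℤ._* + n) (ℤ.pos-* 2 n))) +b≡)
        h)
    by-sign : Joins origin far m m′ → 2 * n ≤ m + m′
    by-sign (inj₁ h)        = bound (+ m) (+ m′) refl refl h
    by-sign (inj₂ (inj₁ h)) = bound (ℤ.- + m) (+ m′) (ℤ.∣-i∣≡∣i∣ (+ m)) refl
      (subst (λ i → ⟦ far ⟧ ℤ.- ⟦ origin ⟧ ≡ i ℤ.+ + m′ ℤ.* + (3 * n + 1) [mod N ])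
        (ℤ.neg-distribˡ-* (+ m) (+ n)) h)
    by-sign (inj₂ (inj₂ h)) = bound (+ m) (ℤ.- + m′) refl (ℤ.∣-i∣≡∣i∣ (+ m′))
      (subst (λ i → ⟦ far ⟧ ℤ.- ⟦ origin ⟧ ≡ + m ℤ.* + n ℤ.+ i [mod N ])
        (ℤ.neg-distribˡ-* (+ m′) (+ (3 * n + 1))) h)

  hasDiameter-2n : HasDiameter (TQ N n (3 * n + 1) tq) (2 * n)
  hasDiameter-2n = distance≤2n , origin , far ,
    -- The bound is attained by 2n steps of size a = n, which lead from 0 to 2n².
    (2 * n , 0 , +-identityʳ (2 * n) , inj₁ (congruent (+ 0) far≡)) ,
    λ { ℓ (m , m′ , refl , j) → joins-far⇒2n≤ m m′ j }
    where
    far≡ : ⟦ far ⟧ ℤ.- ⟦ origin ⟧ ≡ + (2 * n) ℤ.* + n ℤ.+ + 0 ℤ.* + (3 * n + 1) ℤ.+ + 0 ℤ.* orderᶻ (+ n)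
    far≡ = trans far-origin≡ (sym (trans (ℤ.+-identityʳ _) (ℤ.+-identityʳ _)))

-- Arithmetic of the parameters and conclusion.

-- The truncating division is exact here, its dividend being `5 * n * 2`.
order≡ : ∀ n → (2 * n) ^ 2 + 5 * (2 * n) / 2 + 1 ≡ 4 * n ^ 2 + 5 * n + 1
order≡ n = cong₂ (λ i j → i + j + 1) (square n)
  (trans (cong (_/ 2) (e n)) (m*n/n≡m (5 * n) 2))
  where
  square : ∀ n → 2 * n * (2 * n * 1) ≡ 4 * (n * (n * 1))
  square = ℕ-Ring.solve-∀
  e : ∀ n → 5 * (2 * n) ≡ 5 * n * 2
  e = ℕ-Ring.solve-∀

factored : ∀ n → 4 * n ^ 2 + 5 * n + 1 ≡ (1 + 4 * n) * (1 + n)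
factored = e
  where
  e : ∀ n → 4 * (n * (n * 1)) + 5 * n + 1 ≡ (1 + 4 * n) * (1 + n)
  e = ℕ-Ring.solve-∀

isTQ : ∀ n N → 1 ≤ n → N ≡ (1 + 4 * n) * (1 + n) → IsTQ N n (3 * n + 1)
isTQ n@(suc m) N 1≤n refl = record
  { 2≤N  = ≤-trans (s≤s 1≤n) n<N
  ; 1≤a  = 1≤n
  ; a<N  = n<N
  ; 1≤b  = m≤n+m 1 (3 * n)
  ; b<N  = b<N
  ; gcd1 = trans (cong (gcd N) gcd[a,b]≡1) (gcd-zeroʳ N)
  }
  where
  -- Writing n = m + 1 makes N - b - 1 a polynomial with natural coefficients; at n = 0 one would
  -- have b = N = 1.
  e : ∀ m → (1 + 4 * suc m) * (1 + suc m) ≡ suc (3 * suc m + 1) + (4 * m * m + 10 * m + 5)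
  e = ℕ-Ring.solve-∀
  b<N : 3 * n + 1 < N
  b<N = subst (3 * n + 1 <_) (sym (e m)) (m≤m+n (suc (3 * n + 1)) _)
  n<N : n < N
  n<N = ≤-<-trans (≤-trans (m≤m+n n (2 * n)) (m≤m+n (3 * n) 1)) b<N
  gcd[a,b]≡1 : gcd n (3 * n + 1) ≡ 1
  -- The gcd divides both 3n and 3n + 1, hence 1.
  gcd[a,b]≡1 = ∣1⇒≡1 (∣m+n∣m⇒∣n (gcd[m,n]∣n n (3 * n + 1)) (∣n⇒∣m*n 3 (gcd[m,n]∣m n (3 * n + 1))))

proposition2p1 : ((n : ℕ) → 1 ≤ n →
    let k = 2 * n
        N = k ^ 2 + 5 * k / 2 + 1
        a = n
        b = 3 * n + 1
    in N ≡ 4 * n ^ 2 + 5 * n + 1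
       × (Σ[ p ∈ IsTQ N a b ] HasDiameter (TQ N a b p) k))
    × ((k : ℕ) → 2 ∣ k → 2 ≤ k →
    Σ[ G ∈ ThreeQuartersDigraph ]
      (order G ≡ k ^ 2 + 5 * k / 2 + 1 × HasDiameter G k))
proposition2p1 = family , existence
  where
  family : ∀ n → 1 ≤ n → _
  family n 1≤n = order≡ n , tq , hasDiameter-2n n N N≡ tq
    where
    N  = (2 * n) ^ 2 + 5 * (2 * n) / 2 + 1
    N≡ = trans (order≡ n) (factored n)
    tq = isTQ n N 1≤n N≡
  existence : ∀ k → 2 ∣ k → 2 ≤ k → _
  -- Commuting the product lets `refl` replace `k` by `2 * n`, the exact form used in `family`.
  existence k (divides n k≡n*2) 2≤k with trans k≡n*2 (*-comm n 2)
  ... | refl with family n (*-cancelˡ-≤ 2 2≤k)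
  ...   | _ , tq , diam = TQ _ n (3 * n + 1) tq , refl , diam
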